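{- For each first-order formula $\varphi(X,Y;\tilde P)$ in the language of $\mathcal{E}$ (with $\tilde P$ a tuple of parameter variables) one can effectively find a number $k$ such that for every finite class $\mathbf{R}$ of pairwise disjoint infinite computable sets with $|\mathbf{R}|\ge k$ and every tuple $\tilde A$ of c.e. sets, the relation $\{(X,Y):X,Y\in\mathbf{R},\ \mathcal{E}\models\varphi(X,Y;\tilde A)\}$ is not a linear ordering of $\mathbf{R}$.
   Context: $\mathcal{E}$ is the lattice of c.e. subsets of $\mathbb{N}$ under inclusion. -}

module Defs where

open import Data.Nat using (ℕ; zero; suc; _≤_; _<_)
open import Data.Fin using (Fin)
open import Data.Vec using (Vec; []; _∷_; lookup)
open import Data.Product using (Σ; _×_; _,_)
open import Data.Sum using (_⊎_)
open import Data.Empty using (⊥)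
open import Relation.Nullary using (¬_)
open import Relation.Binary.PropositionalEquality using (_≡_)

data Code : ℕ → Set where
  zer  : ∀ {n} → Code n
  succ : Code 1
  proj : ∀ {n} → Fin n → Code n
  comp : ∀ {n m} → Code m → Vec (Code n) m → Code n
  prec : ∀ {n} → Code n → Code (suc (suc n)) → Code (suc n)
  mu   : ∀ {n} → Code (suc n) → Code n

mutual
  data Eval : ∀ {n} → Code n → Vec ℕ n → ℕ → Set where
    e-zer  : ∀ {n} {xs : Vec ℕ n} → Eval zer xs 0
    e-succ : ∀ {x} → Eval succ (x ∷ []) (suc x)
    e-proj : ∀ {n} {i : Fin n} {xs} → Eval (proj i) xs (lookup xs i)
    e-comp : ∀ {n m} {f : Code m} {gs : Vec (Code n) m} {xs ys y} →
             EvalAll gs xs ys → Eval f ys y → Eval (comp f gs) xs y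
    e-prec0 : ∀ {n} {f : Code n} {g} {xs y} →
             Eval f xs y → Eval (prec f g) (0 ∷ xs) y
    e-precS : ∀ {n} {f : Code n} {g} {x xs z y} →
             Eval (prec f g) (x ∷ xs) z → Eval g (x ∷ z ∷ xs) y →
             Eval (prec f g) (suc x ∷ xs) y
    e-mu   : ∀ {n} {f : Code (suc n)} {xs y} →
             Eval f (y ∷ xs) 0 →
             (∀ i → i < y → Σ ℕ (λ v → Eval f (i ∷ xs) (suc v))) →
             Eval (mu f) xs y

  data EvalAll : ∀ {n m} → Vec (Code n) m → Vec ℕ n → Vec ℕ m → Set where
    ea-[] : ∀ {n} {xs : Vec ℕ n} → EvalAll [] xs []
    ea-∷  : ∀ {n m} {g : Code n} {gs : Vec (Code n) m} {xs y ys} →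
            Eval g xs y → EvalAll gs xs ys → EvalAll (g ∷ gs) xs (y ∷ ys)

CE : Set
CE = Code 1

_∈W_ : ℕ → CE → Set
x ∈W c = Σ ℕ (λ y → Eval c (x ∷ []) y)

Computable : CE → Set
Computable c = Σ (Code 1) (λ f → ∀ x →
  (Eval f (x ∷ []) 0 × ¬ (x ∈W c)) ⊎ (Eval f (x ∷ []) 1 × x ∈W c))

Infinite : CE → Set
Infinite c = ∀ m → Σ ℕ (λ x → m ≤ x × x ∈W c)

Disjoint : CE → CE → Set
Disjoint c d = ∀ x → x ∈W c → x ∈W d → ⊥

-- First-order formulas in the language {⊆} of the lattice ℰ,
-- with de Bruijn variables (Fin n = free variables).

data Formula : ℕ → Set where
  _⊑_  : ∀ {n} → Fin n → Fin n → Formula n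
  ⊥'   : ∀ {n} → Formula n
  _∧'_ : ∀ {n} → Formula n → Formula n → Formula n
  _∨'_ : ∀ {n} → Formula n → Formula n → Formula n
  _⇒'_ : ∀ {n} → Formula n → Formula n → Formula n
  ∀'   : ∀ {n} → Formula (suc n) → Formula n
  ∃'   : ∀ {n} → Formula (suc n) → Formula n

extend : ∀ {n} → CE → (Fin n → CE) → Fin (suc n) → CE
extend c ρ Fin.zero    = c
extend c ρ (Fin.suc i) = ρ i

-- Classical (double-negation) satisfaction in ℰ; quantifiers range
-- over all c.e. sets (via their codes); ⊆ is extensional inclusion.
_⊨_ : ∀ {n} → (Fin n → CE) → Formula n → Set
ρ ⊨ (i ⊑ j)  = ¬ ¬ (∀ x → x ∈W ρ i → x ∈W ρ j)
ρ ⊨ ⊥'       = ⊥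
ρ ⊨ (φ ∧' ψ) = (ρ ⊨ φ) × (ρ ⊨ ψ)
ρ ⊨ (φ ∨' ψ) = ¬ ¬ ((ρ ⊨ φ) ⊎ (ρ ⊨ ψ))
ρ ⊨ (φ ⇒' ψ) = (ρ ⊨ φ) → (ρ ⊨ ψ)
ρ ⊨ ∀' φ     = ∀ c → extend c ρ ⊨ φ
ρ ⊨ ∃' φ     = ¬ ¬ Σ CE (λ c → extend c ρ ⊨ φ)

IsLinearOrder : ∀ {n} → (Fin n → Fin n → Set) → Set
IsLinearOrder {n} R =
  (∀ i → R i i) ×
  (∀ i j → R i j → R j i → i ≡ j) ×
  (∀ i j k → R i j → R j k → R i k) ×
  (∀ i j → ¬ ¬ (R i j ⊎ R j i))

DefRel : ∀ {m n} → Formula (suc (suc m)) → (Fin n → CE) → Vec CE m →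
         Fin n → Fin n → Set
DefRel φ R A i j = (λ v → lookup (R i ∷ R j ∷ A) v) ⊨ φ

{-# OPTIONS --safe #-}
-- A Feferman–Vaught argument.  For a computable set P, the truth of φ in ℰ
-- depends only on a "type" of the traces on P and a type of the traces on the
-- complement, and the number of possible types is bounded in terms of φ alone.
-- If there are more sets in 𝐑 than pairs of types, then two of them, P and Q,
-- carry the same type of (everything, ∅, Ã) and the same type of
-- (∅, everything, Ã).  Interchanging the roles of P and Q then shows that
-- φ(P,Q;Ã) and φ(Q,P;Ã) are equivalent, so φ cannot be both
-- total and antisymmetric on 𝐑.
module Submission where

open import Defs
open import Data.Nat using (ℕ; zero; suc; _≤_; _+_; _*_; _^_)
open import Data.Nat.Properties using (<-cmp)
open import Data.Fin using (Fin; zero; suc; combine; remQuot; funToFin; finToFun)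
open import Data.Fin.Properties using (remQuot-combine; finToFun-funToFin; pigeonhole; sequence; <⇒≢; combine-injective)
open import Data.Vec using (Vec; []; _∷_; lookup)
open import Data.Product using (Σ; _×_; _,_; proj₁; proj₂)
open import Data.Sum using (inj₁; inj₂; [_,_])
open import Data.Empty using (⊥-elim)
open import Data.Unit using (⊤; tt)
open import Effect.Monad using (RawMonad)
open import Function using (_∘_; id; _⇔_; mk⇔; Equivalence)
open import Function.Construct.Symmetry using (⇔-sym)
open import Function.Construct.Identity using (⇔-id)
open import Function.Construct.Composition using (_⇔-∘_)
open import Level using (0ℓ)
open import Relation.Binary.Definitions using (tri<; tri≈; tri>)
open import Relation.Binary.PropositionalEquality using (_≡_; refl; sym; cong₂; subst)
open import Relation.Nullary using (¬_; Dec; yes; no; ¬¬-excluded-middle)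
open import Relation.Nullary.Negation using (¬¬-Monad; ¬¬-map; negated-stable)

open RawMonad (¬¬-Monad {0ℓ}) using (rawApplicative; pure; _>>=_)
open Equivalence using (to; from)

-- Determinism of evaluation.

mutual
  Eval-deterministic : ∀ {n} {c : Code n} {xs y z} → Eval c xs y → Eval c xs z → y ≡ z
  Eval-deterministic e-zer e-zer = refl
  Eval-deterministic e-succ e-succ = refl
  Eval-deterministic e-proj e-proj = refl
  Eval-deterministic (e-comp gs f) (e-comp gs′ f′)
    with refl ← EvalAll-deterministic gs gs′ = Eval-deterministic f f′
  Eval-deterministic (e-prec0 f) (e-prec0 f′) = Eval-deterministic f f′
  Eval-deterministic (e-precS r g) (e-precS r′ g′)
    with refl ← Eval-deterministic r r′ = Eval-deterministic g g′
  Eval-deterministic (e-mu {y = y} f below) (e-mu {y = y′} f′ below′) with <-cmp y y′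
  ... | tri≈ _ y≡y′ _ = y≡y′
  ... | tri< y<y′ _ _ with () ← Eval-deterministic f (proj₂ (below′ y y<y′))
  ... | tri> _ _ y′<y with () ← Eval-deterministic (proj₂ (below y′ y′<y)) f′

  EvalAll-deterministic : ∀ {n m} {gs : Vec (Code n) m} {xs ys zs} →
                          EvalAll gs xs ys → EvalAll gs xs zs → ys ≡ zs
  EvalAll-deterministic ea-[] ea-[] = refl
  EvalAll-deterministic (ea-∷ g gs) (ea-∷ g′ gs′) =
    cong₂ _∷_ (Eval-deterministic g g′) (EvalAll-deterministic gs gs′)

-- Splicing c.e. sets along a computable set.

everything nothing : CE
everything = zer
nothing    = mu (comp succ (zer ∷ []))

∈-everything : ∀ {x} → x ∈W everything
∈-everything = 0 , e-zer

∉-nothing : ∀ {x} → ¬ x ∈W nothing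
∉-nothing (_ , e-mu (e-comp _ ()) _)

-- Composition is strict, so the only way to avoid running a is to make it the
-- step function of a recursion of length χ(x).
guard : CE → CE → CE
guard χ a = comp (prec zer (comp a (proj (suc (suc zero)) ∷ []))) (χ ∷ proj zero ∷ [])

negate : CE → CE
negate χ = comp (prec (comp succ (zer ∷ [])) zer) (χ ∷ [])

-- A guard that is off halts, so asking both guards to halt leaves only the condition of the active
-- one. The value is irrelevant, since a c.e. set is the domain of its code.
pick : CE → CE → CE → CE
pick χ a b = comp zer (guard χ a ∷ guard (negate χ) b ∷ [])

module _ {χ : CE} {x : ℕ} where

  guard-off : ∀ {a} → Eval χ (x ∷ []) 0 → x ∈W guard χ a
  guard-off χ0 = 0 , e-comp (ea-∷ χ0 (ea-∷ e-proj ea-[])) (e-prec0 e-zer)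

  guard-on : ∀ {a} → Eval χ (x ∷ []) 1 → x ∈W guard χ a ⇔ x ∈W a
  guard-on {a} χ1 = mk⇔ run λ (y , e) →
    y , e-comp (ea-∷ χ1 (ea-∷ e-proj ea-[]))
               (e-precS (e-prec0 e-zer) (e-comp (ea-∷ e-proj ea-[]) e))
    where
    run : x ∈W guard χ a → x ∈W a
    run (y , e-comp (ea-∷ χv (ea-∷ e-proj ea-[])) r)
      with refl ← Eval-deterministic χ1 χv
      with e-precS _ (e-comp (ea-∷ e-proj ea-[]) e) ← r = y , e

  negate-0 : Eval χ (x ∷ []) 0 → Eval (negate χ) (x ∷ []) 1
  negate-0 χ0 = e-comp (ea-∷ χ0 ea-[]) (e-prec0 (e-comp (ea-∷ e-zer ea-[]) e-succ))

  negate-1 : Eval χ (x ∷ []) 1 → Eval (negate χ) (x ∷ []) 0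
  negate-1 χ1 = e-comp (ea-∷ χ1 ea-[])
    (e-precS (e-prec0 (e-comp (ea-∷ e-zer ea-[]) e-succ)) e-zer)

∈-pick : ∀ {χ a b x} → x ∈W pick χ a b ⇔ (x ∈W guard χ a × x ∈W guard (negate χ) b)
∈-pick = mk⇔
  (λ { (_ , e-comp (ea-∷ g (ea-∷ h ea-[])) _) → (_ , g) , (_ , h) })
  (λ { ((_ , g) , (_ , h)) → 0 , e-comp (ea-∷ g (ea-∷ h ea-[])) e-zer })

pick-1 : ∀ {χ a b x} → Eval χ (x ∷ []) 1 → x ∈W pick χ a b ⇔ x ∈W a
pick-1 χ1 = mk⇔
  (to (guard-on χ1) ∘ proj₁ ∘ to ∈-pick)
  (λ x∈a → from ∈-pick (from (guard-on χ1) x∈a , guard-off (negate-1 χ1)))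

pick-0 : ∀ {χ a b x} → Eval χ (x ∷ []) 0 → x ∈W pick χ a b ⇔ x ∈W b
pick-0 χ0 = mk⇔
  (to (guard-on (negate-0 χ0)) ∘ proj₂ ∘ to ∈-pick)
  (λ x∈b → from ∈-pick (guard-off χ0 , from (guard-on (negate-0 χ0)) x∈b))

module _ {P : CE} (P-comp : Computable P) where

  open Σ P-comp renaming (proj₁ to χ; proj₂ to χ-spec)

  Computable-dec : ∀ x → Dec (x ∈W P)
  Computable-dec x with χ-spec x
  ... | inj₁ (_ , x∉P) = no x∉P
  ... | inj₂ (_ , x∈P) = yes x∈P

  pick-inside : ∀ {a b x} → x ∈W P → x ∈W pick χ a b ⇔ x ∈W a
  pick-inside {x = x} x∈P with χ-spec x
  ... | inj₁ (_ , x∉P) = ⊥-elim (x∉P x∈P)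
  ... | inj₂ (χ1 , _)  = pick-1 χ1

  pick-outside : ∀ {a b x} → ¬ x ∈W P → x ∈W pick χ a b ⇔ x ∈W b
  pick-outside {x = x} x∉P with χ-spec x
  ... | inj₁ (χ0 , _)  = pick-0 χ0
  ... | inj₂ (_ , x∈P) = ⊥-elim (x∉P x∈P)

-- Stability of satisfaction, and agreement of environments on a set.

⊨-stable : ∀ {n} (φ : Formula n) {ρ} → ¬ ¬ (ρ ⊨ φ) → ρ ⊨ φ
⊨-stable (i ⊑ j)  h = negated-stable h
⊨-stable ⊥'       h = h λ ()
⊨-stable (φ ∧' ψ) h = ⊨-stable φ (¬¬-map proj₁ h) , ⊨-stable ψ (¬¬-map proj₂ h)
⊨-stable (φ ∨' ψ) h = negated-stable h
⊨-stable (φ ⇒' ψ) h = λ p → ⊨-stable ψ (¬¬-map (λ f → f p) h)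
⊨-stable (∀' φ)   h = λ c → ⊨-stable φ (¬¬-map (λ f → f c) h)
⊨-stable (∃' φ)   h = negated-stable h

Env : ℕ → Set
Env n = Fin n → CE

Agree : ∀ {n} → (ℕ → Set) → Env n → Env n → Set
Agree P ρ σ = ∀ i {x} → P x → x ∈W ρ i ⇔ x ∈W σ i

Agree-sym : ∀ {n P} {ρ σ : Env n} → Agree P ρ σ → Agree P σ ρ
Agree-sym agree i Px = ⇔-sym (agree i Px)

Agree-extend : ∀ {n P c d} {ρ σ : Env n} → (∀ {x} → P x → x ∈W c ⇔ x ∈W d) →
               Agree P ρ σ → Agree P (extend c ρ) (extend d σ)
Agree-extend c≈d agree zero    = c≈d
Agree-extend c≈d agree (suc i) = agree i

-- Finitely many types for each formula.

Truth : Fin 2 → Set → Set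
Truth zero    A = ¬ A
Truth (suc _) A = ¬ ¬ A

Truth-map : ∀ {A B} b → A ⇔ B → Truth b A → Truth b B
Truth-map zero    A⇔B ¬A  = ¬A ∘ from A⇔B
Truth-map (suc _) A⇔B ¬¬A = ¬¬-map (to A⇔B) ¬¬A

Truth-transfer : ∀ {A B} b → Truth b A → Truth b B → A → ¬ ¬ B
Truth-transfer zero    ¬A _   a = ⊥-elim (¬A a)
Truth-transfer (suc _) _  ¬¬B _ = ¬¬B

Truth-total : ∀ A → ¬ ¬ Σ (Fin 2) λ b → Truth b A
Truth-total A = ¬¬-map (λ { (yes a) → suc zero , pure a ; (no ¬a) → zero , ¬a }) ¬¬-excluded-middle

-- A type of a connective is a pair of types; a type of a quantified formula is a set of types of
-- its body, coded by bits in `Fin 2`.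
typeCount : ∀ {n} → Formula n → ℕ
typeCount (i ⊑ j)  = 2
typeCount ⊥'       = 1
typeCount (φ ∧' ψ) = typeCount φ * typeCount ψ
typeCount (φ ∨' ψ) = typeCount φ * typeCount ψ
typeCount (φ ⇒' ψ) = typeCount φ * typeCount ψ
typeCount (∀' φ)   = 2 ^ typeCount φ
typeCount (∃' φ)   = 2 ^ typeCount φ

Type : ∀ {n} → Formula n → Set
Type φ = Fin (typeCount φ)

-- HasType P ρ φ t : the traces of ρ on P have φ-type t.  The type does not
-- determine the truth of φ on P; it records the truth of the atoms and, for
-- a quantifier, which types are realised by some extension of ρ.
mutual
  HasType : ∀ {n} → (ℕ → Set) → Env n → (φ : Formula n) → Type φ → Set
  HasType P ρ (i ⊑ j)  t = Truth t (∀ x → P x → x ∈W ρ i → x ∈W ρ j)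
  HasType P ρ ⊥'       t = ⊤
  HasType P ρ (φ ∧' ψ) t = HasTypes P ρ φ ψ (remQuot (typeCount ψ) t)
  HasType P ρ (φ ∨' ψ) t = HasTypes P ρ φ ψ (remQuot (typeCount ψ) t)
  HasType P ρ (φ ⇒' ψ) t = HasTypes P ρ φ ψ (remQuot (typeCount ψ) t)
  HasType P ρ (∀' φ)   t = ∀ s → Realised P ρ φ s (finToFun t s)
  HasType P ρ (∃' φ)   t = ∀ s → Realised P ρ φ s (finToFun t s)

  HasTypes : ∀ {n} → (ℕ → Set) → Env n → (φ ψ : Formula n) → Type φ × Type ψ → Set
  HasTypes P ρ φ ψ (t , u) = HasType P ρ φ t × HasType P ρ ψ u

  Realised : ∀ {n} → (ℕ → Set) → Env n → (φ : Formula (suc n)) → Type φ → Fin 2 → Set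
  Realised P ρ φ s b = Truth b (Σ CE λ c → HasType P (extend c ρ) φ s)

mutual
  HasType-total : ∀ {n} P (ρ : Env n) φ → ¬ ¬ Σ (Type φ) (HasType P ρ φ)
  HasType-total P ρ (i ⊑ j)  = Truth-total _
  HasType-total P ρ ⊥'       = pure (zero , tt)
  HasType-total P ρ (φ ∧' ψ) = HasTypes-total P ρ φ ψ
  HasType-total P ρ (φ ∨' ψ) = HasTypes-total P ρ φ ψ
  HasType-total P ρ (φ ⇒' ψ) = HasTypes-total P ρ φ ψ
  HasType-total P ρ (∀' φ)   = Realised-total P ρ φ
  HasType-total P ρ (∃' φ)   = Realised-total P ρ φ

  HasTypes-total : ∀ {n} P (ρ : Env n) φ ψ →
    ¬ ¬ Σ (Fin (typeCount φ * typeCount ψ)) (HasTypes P ρ φ ψ ∘ remQuot (typeCount ψ))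
  HasTypes-total P ρ φ ψ = do
    t , φ∶t ← HasType-total P ρ φ
    u , ψ∶u ← HasType-total P ρ ψ
    pure (combine t u , subst (HasTypes P ρ φ ψ) (sym (remQuot-combine t u)) (φ∶t , ψ∶u))

  Realised-total : ∀ {n} P (ρ : Env n) φ →
    ¬ ¬ Σ (Fin (2 ^ typeCount φ)) (λ t → ∀ s → Realised P ρ φ s (finToFun t s))
  Realised-total P ρ φ = do
    -- Double negation commutes with products over a finite index set, so the bits of all types can
    -- be settled at once.
    bits ← sequence rawApplicative (λ s → Truth-total (Σ CE λ c → HasType P (extend c ρ) φ s))
    pure (funToFin (proj₁ ∘ bits) , λ s →
      subst (Realised P ρ φ s) (sym (finToFun-funToFin (proj₁ ∘ bits) s)) (proj₂ (bits s)))

mutual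
  -- Atoms are relativised to `P`, and at a quantifier the same witness `c` serves both
  -- environments.
  HasType-agree : ∀ {n P} {ρ σ : Env n} → Agree P ρ σ → ∀ φ {t} → HasType P ρ φ t → HasType P σ φ t
  HasType-agree agree (i ⊑ j) {t} = Truth-map t (mk⇔
    (λ ⊆ρ x Px → to (agree j Px) ∘ ⊆ρ x Px ∘ from (agree i Px))
    (λ ⊆σ x Px → from (agree j Px) ∘ ⊆σ x Px ∘ to (agree i Px)))
  HasType-agree agree ⊥' = λ _ → tt
  HasType-agree agree (φ ∧' ψ) = HasTypes-agree agree φ ψ
  HasType-agree agree (φ ∨' ψ) = HasTypes-agree agree φ ψ
  HasType-agree agree (φ ⇒' ψ) = HasTypes-agree agree φ ψ
  HasType-agree agree (∀' φ) {t} ρ∶t s = Realised-agree agree φ (finToFun t s) (ρ∶t s)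
  HasType-agree agree (∃' φ) {t} ρ∶t s = Realised-agree agree φ (finToFun t s) (ρ∶t s)

  HasTypes-agree : ∀ {n P} {ρ σ : Env n} → Agree P ρ σ → ∀ φ ψ {tu} →
                   HasTypes P ρ φ ψ tu → HasTypes P σ φ ψ tu
  HasTypes-agree agree φ ψ (φ∶t , ψ∶u) = HasType-agree agree φ φ∶t , HasType-agree agree ψ ψ∶u

  Realised-agree : ∀ {n P} {ρ σ : Env n} → Agree P ρ σ → ∀ φ {s} b →
                   Realised P ρ φ s b → Realised P σ φ s b
  Realised-agree agree φ b = Truth-map b (mk⇔
    (λ (c , c∶s) → c , HasType-agree (Agree-extend (λ _ → ⇔-id _) agree) φ c∶s)
    (λ (c , c∶s) → c , HasType-agree (Agree-extend (λ _ → ⇔-id _) (Agree-sym agree)) φ c∶s))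

-- Comparing traces on two sets.

SameType : ∀ {n} → Formula n → (ℕ → Set) → Env n → (ℕ → Set) → Env n → Set
SameType φ P ρ Q σ = Σ (Type φ) λ t → HasType P ρ φ t × HasType Q σ φ t

SameType-sym : ∀ {n} (φ : Formula n) {P ρ Q σ} → SameType φ P ρ Q σ → SameType φ Q σ P ρ
SameType-sym φ (t , ρ∶t , σ∶t) = t , σ∶t , ρ∶t

-- The type `s` of `extend c ρ` is realised over `ρ`, so `t` cannot record it as unrealised; the
-- same bit of `t` then yields a `d` over `σ`.
SameType-extend : ∀ {n} (φ : Formula (suc n)) {P ρ Q σ} → SameType (∀' φ) P ρ Q σ →
                  ∀ c → ¬ ¬ Σ CE λ d → SameType φ P (extend c ρ) Q (extend d σ)
SameType-extend φ {P} {ρ} (t , ρ∶t , σ∶t) c = do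
  s , c∶s ← HasType-total P (extend c ρ) φ
  d , d∶s ← Truth-transfer (finToFun t s) (ρ∶t s) (σ∶t s) (c , c∶s)
  pure (d , s , c∶s , d∶s)

SameType-agreeʳ : ∀ {n} (φ : Formula n) {P ρ Q σ τ} → Agree Q σ τ →
                  SameType φ P ρ Q σ → SameType φ P ρ Q τ
SameType-agreeʳ φ agree (t , ρ∶t , σ∶t) = t , ρ∶t , HasType-agree agree φ σ∶t

-- Interchanging two disjoint computable sets.

module Interchange {P Q : CE} (P-comp : Computable P) (Q-comp : Computable Q)
                   (P∩Q=∅ : Disjoint P Q) where

  Rest : ℕ → Set
  Rest x = ¬ x ∈W P × ¬ x ∈W Q

  -- The invariant of a back-and-forth argument: quantifier moves preserve it, and atoms can be read
  -- off from it.
  record Interchanged {n} (φ : Formula n) (ρ σ : Env n) : Set where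
    constructor interchanged
    field
      P⇒Q  : SameType φ (_∈W P) ρ (_∈W Q) σ
      Q⇒P  : SameType φ (_∈W Q) ρ (_∈W P) σ
      rest : Agree Rest ρ σ

  Interchanged-sym : ∀ {n} (φ : Formula n) {ρ σ} → Interchanged φ ρ σ → Interchanged φ σ ρ
  Interchanged-sym φ (interchanged p q r) =
    interchanged (SameType-sym φ q) (SameType-sym φ p) (Agree-sym r)

  Interchanged-extend : ∀ {n} (φ : Formula (suc n)) {ρ σ} → Interchanged (∀' φ) ρ σ →
                        ∀ c → ¬ ¬ Σ CE λ d → Interchanged φ (extend c ρ) (extend d σ)
  Interchanged-extend φ {ρ} {σ} (interchanged p q r) c = do
    d-Q , p′ ← SameType-extend φ p c
    d-P , q′ ← SameType-extend φ q c
    -- The answer to `c` is `d-P` on `P`, `d-Q` on `Q` and `c` elsewhere; computability of both sets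
    -- makes this splice c.e.
    let inner = pick (proj₁ Q-comp) d-Q c
    pure (pick (proj₁ P-comp) d-P inner , interchanged
      (SameType-agreeʳ φ (Agree-extend
        -- Disjointness keeps the outer splice along `P` from overwriting the values on `Q`.
        (λ x∈Q → ⇔-sym (pick-inside Q-comp x∈Q ⇔-∘ pick-outside P-comp (λ x∈P → P∩Q=∅ _ x∈P x∈Q)))
        (λ _ _ → ⇔-id _)) p′)
      (SameType-agreeʳ φ (Agree-extend
        (λ x∈P → ⇔-sym (pick-inside P-comp x∈P))
        (λ _ _ → ⇔-id _)) q′)
      (Agree-extend
        (λ (x∉P , x∉Q) → ⇔-sym (pick-outside Q-comp x∉Q ⇔-∘ pick-outside P-comp x∉P))
        r))

  -- Inclusion can be checked separately on `P`, on `Q` and on the rest, because membership in both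
  -- sets is decidable.
  Interchanged-⊑ : ∀ {n} {i j : Fin n} {ρ σ} → Interchanged (i ⊑ j) ρ σ →
                   ρ ⊨ (i ⊑ j) → σ ⊨ (i ⊑ j)
  Interchanged-⊑ {i = i} {j} {ρ} {σ} (interchanged (t , ρ∶t , σ∶t) (u , ρ∶u , σ∶u) r) h = do
    ρᵢ⊆ρⱼ ← h
    onQ ← Truth-transfer t ρ∶t σ∶t (λ x _ → ρᵢ⊆ρⱼ x)
    onP ← Truth-transfer u ρ∶u σ∶u (λ x _ → ρᵢ⊆ρⱼ x)
    pure (glue ρᵢ⊆ρⱼ onP onQ)
    where
    glue : (∀ x → x ∈W ρ i → x ∈W ρ j) →
           (∀ x → x ∈W P → x ∈W σ i → x ∈W σ j) →
           (∀ x → x ∈W Q → x ∈W σ i → x ∈W σ j) →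
           ∀ x → x ∈W σ i → x ∈W σ j
    glue ρᵢ⊆ρⱼ onP onQ x with Computable-dec P-comp x | Computable-dec Q-comp x
    ... | yes x∈P | _       = onP x x∈P
    ... | no _    | yes x∈Q = onQ x x∈Q
    ... | no x∉P  | no x∉Q  = to (r j (x∉P , x∉Q)) ∘ ρᵢ⊆ρⱼ x ∘ from (r i (x∉P , x∉Q))

  -- Serves ∨' and ⇒' as well: once the record is repacked, their types are those of ∧'.
  Interchanged-split : ∀ {n} (φ ψ : Formula n) {ρ σ} → Interchanged (φ ∧' ψ) ρ σ →
                       Interchanged φ ρ σ × Interchanged ψ ρ σ
  Interchanged-split φ ψ (interchanged (_ , (ρ∶t , ρ∶t′) , (σ∶t , σ∶t′)) (_ , (ρ∶u , ρ∶u′) , (σ∶u , σ∶u′)) r) =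
    interchanged (_ , ρ∶t , σ∶t) (_ , ρ∶u , σ∶u) r ,
    interchanged (_ , ρ∶t′ , σ∶t′) (_ , ρ∶u′ , σ∶u′) r

  Interchanged-⊨ : ∀ {n} (φ : Formula n) {ρ σ} → Interchanged φ ρ σ → ρ ⊨ φ → σ ⊨ φ
  Interchanged-⊨ (i ⊑ j) I h = Interchanged-⊑ I h
  Interchanged-⊨ ⊥' _ h = h
  Interchanged-⊨ (φ ∧' ψ) I (hφ , hψ) =
    let I₁ , I₂ = Interchanged-split φ ψ I in Interchanged-⊨ φ I₁ hφ , Interchanged-⊨ ψ I₂ hψ
  Interchanged-⊨ (φ ∨' ψ) (interchanged p q r) =
    let I₁ , I₂ = Interchanged-split φ ψ (interchanged p q r)
    in ¬¬-map [ inj₁ ∘ Interchanged-⊨ φ I₁ , inj₂ ∘ Interchanged-⊨ ψ I₂ ]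
  Interchanged-⊨ (φ ⇒' ψ) (interchanged p q r) h =
    let I₁ , I₂ = Interchanged-split φ ψ (interchanged p q r)
    in Interchanged-⊨ ψ I₂ ∘ h ∘ Interchanged-⊨ φ (Interchanged-sym φ I₁)
  -- By symmetry `c` over `σ` is matched by some `d` over `ρ`, where `h` applies; stability removes
  -- the double negation around `d`.
  Interchanged-⊨ (∀' φ) I h c = ⊨-stable φ (do
    d , I′ ← Interchanged-extend φ (Interchanged-sym (∀' φ) I) c
    pure (Interchanged-⊨ φ (Interchanged-sym φ I′) (h d)))
  Interchanged-⊨ (∃' φ) (interchanged p q r) h = do
    c , hc ← h
    d , I′ ← Interchanged-extend φ (interchanged p q r) c
    pure (d , Interchanged-⊨ φ I′ hc)

-- From equal types to the interchange of a pair.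

env : ∀ {m} → CE → CE → Vec CE m → Env (2 + m)
env X Y A = lookup (X ∷ Y ∷ A)

Agree-env : ∀ {m S X X′ Y Y′} {A : Vec CE m} →
            (∀ {x} → S x → x ∈W X ⇔ x ∈W X′) → (∀ {x} → S x → x ∈W Y ⇔ x ∈W Y′) →
            Agree S (env X Y A) (env X′ Y′ A)
Agree-env X≈X′ Y≈Y′ zero          = X≈X′
Agree-env X≈X′ Y≈Y′ (suc zero)    = Y≈Y′
Agree-env X≈X′ Y≈Y′ (suc (suc _)) = λ _ → ⇔-id _

always : ∀ {A B : Set} → A → B → A ⇔ B
always a b = mk⇔ (λ _ → b) (λ _ → a)

never : ∀ {A B : Set} → ¬ A → ¬ B → A ⇔ B
never ¬a ¬b = mk⇔ (⊥-elim ∘ ¬a) (⊥-elim ∘ ¬b)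

module _ {m} (φ : Formula (2 + m)) (A : Vec CE m) where

  -- On `P`, the set `P` looks like `everything` and any set disjoint from it like `nothing`. These
  -- types therefore do not depend on the partner, and pigeonhole can run over single sets.
  FirstType SecondType : CE → Type φ → Set
  FirstType  P = HasType (_∈W P) (env everything nothing A) φ
  SecondType P = HasType (_∈W P) (env nothing everything A) φ

  -- The first types compare (P,Q) on P with (Q,P) on Q, the second types (P,Q) on Q with (Q,P) on
  -- P. Off both sets, all traces are empty.
  interchange-same-types : ∀ {P Q} → Computable P → Computable Q → Disjoint P Q → ∀ {t u} →
    FirstType P t → FirstType Q t → SecondType P u → SecondType Q u →
    env P Q A ⊨ φ → env Q P A ⊨ φ
  interchange-same-types {P} {Q} P-comp Q-comp P∩Q=∅ {t} {u} P∶t Q∶t P∶u Q∶u =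
    Interchanged-⊨ φ (interchanged
      (t , HasType-agree (first P∩Q=∅) φ P∶t , HasType-agree (first Q∩P=∅) φ Q∶t)
      (u , HasType-agree (second Q∩P=∅) φ Q∶u , HasType-agree (second P∩Q=∅) φ P∶u)
      (Agree-env (λ (x∉P , x∉Q) → never x∉P x∉Q) (λ (x∉P , x∉Q) → never x∉Q x∉P)))
    where
    open Interchange P-comp Q-comp P∩Q=∅

    Q∩P=∅ : Disjoint Q P
    Q∩P=∅ x x∈Q x∈P = P∩Q=∅ x x∈P x∈Q

    first : ∀ {S T} → Disjoint S T → Agree (_∈W S) (env everything nothing A) (env S T A)
    first S∩T=∅ = Agree-env (always ∈-everything) (λ x∈S → never ∉-nothing (S∩T=∅ _ x∈S))

    second : ∀ {S T} → Disjoint S T → Agree (_∈W S) (env nothing everything A) (env T S A)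
    second S∩T=∅ = Agree-env (λ x∈S → never ∉-nothing (S∩T=∅ _ x∈S)) (always ∈-everything)

theorem4p22 : Σ (∀ {m} → Formula (2 + m) → ℕ) (λ k →
    ∀ (m : ℕ) (φ : Formula (2 + m)) (n : ℕ) → k φ ≤ n →
    (R : Fin n → CE) →
    (∀ i → Computable (R i)) →
    (∀ i → Infinite (R i)) →
    (∀ i j → ¬ (i ≡ j) → Disjoint (R i) (R j)) →
    (A : Vec CE m) →
    ¬ IsLinearOrder (DefRel φ R A))
-- One more than the number of pairs of types, so that `k φ ≤ n` is the strict inequality of the
-- pigeonhole principle.
theorem4p22 = (λ φ → suc (typeCount φ * typeCount φ)) ,
  λ m φ n k≤n R R-comp _ R-disj A (_ , antisym , _ , total) →
    (do
      t ← sequence rawApplicative (λ i → HasType-total (_∈W R i) (env everything nothing A) φ)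
      u ← sequence rawApplicative (λ i → HasType-total (_∈W R i) (env nothing everything A) φ)
      let i , j , i<j , same = pigeonhole k≤n (λ i → combine (proj₁ (t i)) (proj₁ (u i)))
          tᵢ≡tⱼ , uᵢ≡uⱼ = combine-injective (proj₁ (t i)) (proj₁ (u i)) (proj₁ (t j)) (proj₁ (u j)) same
          i≢j = <⇒≢ i<j
          tⱼ = subst (FirstType φ A (R j)) (sym tᵢ≡tⱼ) (proj₂ (t j))
          uⱼ = subst (SecondType φ A (R j)) (sym uᵢ≡uⱼ) (proj₂ (u j))
          forth = interchange-same-types φ A (R-comp i) (R-comp j) (R-disj i j i≢j)
                    (proj₂ (t i)) tⱼ (proj₂ (u i)) uⱼ
          back  = interchange-same-types φ A (R-comp j) (R-comp i) (R-disj j i (i≢j ∘ sym))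
                    tⱼ (proj₂ (t i)) uⱼ (proj₂ (u i))
      i≤j∨j≤i ← total i j
      -- Whichever comparison totality supplies, the interchange supplies its converse.
      pure (i≢j ([ (λ i≤j → antisym i j i≤j (forth i≤j))
                 , (λ j≤i → antisym i j (back j≤i) j≤i) ] i≤j∨j≤i)))
    id
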